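{- There is no finite paraconsistent BALFI satisfying both $(\mathrm{ce})$ and $(\mathrm{cf})$.
   Context: A BALFI (Boolean algebra with LFI operators) is an algebra $\mathbf{B}=\langle B,\wedge,\vee,\to,\neg,\circ,0,1\rangle$, with unary operations $\neg,\circ$, such that $\langle B,\wedge,\vee,\to,0,1\rangle$ is a Boolean algebra and, for every $a\in B$, $a\vee\neg a=1$ and $a\wedge\neg a\wedge\circ a=0$ (in general $\neg$ is not the Boolean complement). A BALFI is paraconsistent if $a\wedge\neg a\neq 0$ for some $a\in B$. A BALFI satisfies $(\mathrm{ce})$ if $a\wedge\neg\neg a=a$ for all $a$ (i.e. $a\leq\neg\neg a$), and satisfies $(\mathrm{cf})$ if $a\wedge\neg\neg a=\neg\neg a$ for all $a$ (i.e. $\neg\neg a\leq a$). -}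

module Defs where

open import Level using (Level; suc; _⊔_)
open import Algebra.Core using (Op₁; Op₂)
open import Algebra.Definitions using (Congruent₁)
open import Algebra.Lattice.Structures using (IsBooleanAlgebra)
open import Data.Fin.Base using (Fin)
open import Data.Product.Base using (∃-syntax)
open import Function.Bundles using (Inverse)
open import Relation.Binary.Bundles using (Setoid)
open import Relation.Binary.Core using (Rel)
import Relation.Binary.PropositionalEquality.Properties as ≡

private
  variable
    c ℓ : Level

-- A Boolean algebra in the signature ∧, ∨, ⟶, 0, 1: its complement is not a
-- primitive operation but the term a ⟶ 0.  The operation ¬ is a different one.
-- ⟶ respects _≈_ by ⟶-def and the congruence of the complement and of ∨.
record BALFI (c ℓ : Level) : Set (suc (c ⊔ ℓ)) where
  infix  8 ¬_ ∘_
  infixr 7 _∧_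
  infixr 6 _∨_
  infixr 5 _⟶_
  infix  4 _≈_
  field
    Carrier          : Set c
    _≈_              : Rel Carrier ℓ
    _∧_ _∨_ _⟶_      : Op₂ Carrier
    ¬_ ∘_            : Op₁ Carrier
    0# 1#            : Carrier
    isBooleanAlgebra : IsBooleanAlgebra _≈_ _∨_ _∧_ (_⟶ 0#) 1# 0#
    ⟶-def            : ∀ a b → (a ⟶ b) ≈ (a ⟶ 0#) ∨ b
    ¬-cong           : Congruent₁ _≈_ ¬_
    ∘-cong           : Congruent₁ _≈_ ∘_
    ∨-¬              : ∀ a → a ∨ ¬ a ≈ 1#
    ∧-¬-∘            : ∀ a → a ∧ ¬ a ∧ ∘ a ≈ 0#

  open IsBooleanAlgebra isBooleanAlgebra public
    renaming (¬-cong to complement-cong)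

  setoid : Setoid c ℓ
  setoid = record { isEquivalence = isEquivalence }

  open Setoid setoid public using (_≉_)

module _ (B : BALFI c ℓ) where
  open BALFI B

  Finite : Set (c ⊔ ℓ)
  Finite = ∃[ n ] Inverse setoid (≡.setoid (Fin n))

  Paraconsistent : Set (c ⊔ ℓ)
  Paraconsistent = ∃[ a ] a ∧ ¬ a ≉ 0#

  SatisfiesCe : Set (c ⊔ ℓ)
  SatisfiesCe = ∀ a → a ∧ ¬ ¬ a ≈ a

  SatisfiesCf : Set (c ⊔ ℓ)
  SatisfiesCf = ∀ a → a ∧ ¬ ¬ a ≈ ¬ ¬ a

{-# OPTIONS --safe #-}
-- By (ce) and (cf), ¬ is an involution, so σ a = complement of ¬ a is injective;
-- and a ∨ ¬ a = 1 says exactly that σ a ≤ a.  On a finite poset an injective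
-- deflationary map is the identity, because every orbit is periodic:
-- a = σᵏ⁺¹ a ≤ σ a ≤ a.  Hence ¬ a is the complement of a and a ∧ ¬ a = 0.
module Submission where

open import Defs
open import Algebra.Lattice.Bundles using (BooleanAlgebra)
import Algebra.Lattice.Properties.BooleanAlgebra as BooleanAlgebraProperties
import Algebra.Lattice.Properties.Lattice as LatticeProperties
import Algebra.Lattice.Properties.Semilattice as SemilatticeProperties
open import Data.Fin.Base using (Fin; toℕ)
open import Data.Fin.Properties using (pigeonhole)
open import Data.Nat.Base using (zero; suc; _<_; s<s)
open import Data.Nat.GeneralisedArithmetic using (fold)
open import Data.Nat.Properties using (n<1+n)
open import Data.Product.Base using (∃; _×_; _,_)
open import Function.Bundles using (Injection)
open import Function.Definitions using (Injective)
open import Function.Properties.Inverse using (Inverse⇒Injection)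
open import Level using (Level)
open import Relation.Binary.Bundles using (Poset)
import Relation.Binary.PropositionalEquality.Properties as ≡
import Relation.Binary.Reasoning.Setoid as ≈-Reasoning
open import Relation.Nullary.Negation.Core using (¬_)

module _ {c ℓ₁ ℓ₂} (P : Poset c ℓ₁ ℓ₂)
         {f : Poset.Carrier P → Poset.Carrier P}
         (f-injective : Injective (Poset._≈_ P) (Poset._≈_ P) f)
         (f-deflationary : ∀ x → Poset._≤_ P (f x) x)
         where

  open Poset P

  -- The innermost application of `f` is kept as the bound; each further one, peeled off from the
  -- outside, only moves down.
  fold-suc-≤ : ∀ x n → fold x f (suc n) ≤ f x
  fold-suc-≤ x zero    = refl
  fold-suc-≤ x (suc n) = trans (f-deflationary _) (fold-suc-≤ x n)

  -- Injectivity cancels one outer `f` on each side until the smaller exponent is zero, so the cycle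
  -- passes through `x` itself. The other exponent is then still positive, which is what bounds `x`
  -- by `f x`.
  fold-repeats⇒fixed : ∀ x {i j} → i < j → fold x f i ≈ fold x f j → f x ≈ x
  fold-repeats⇒fixed x {zero}  {suc j} _         eq =
    antisym (f-deflationary x) (trans (reflexive eq) (fold-suc-≤ x j))
  fold-repeats⇒fixed x {suc i} {suc j} (s<s i<j) eq =
    fold-repeats⇒fixed x i<j (f-injective eq)

  finite-deflationary⇒identity :
    ∀ {n} → Injection Eq.setoid (≡.setoid (Fin n)) → ∀ x → f x ≈ x
  finite-deflationary⇒identity {n} ι x
    -- The `suc n` iterates with exponents 0 to `n` are coded in `Fin n`, so two codes agree;
    -- injectivity of `ι` turns this into a repetition in the orbit.
    with _ , _ , i<j , eq ← pigeonhole (n<1+n n) (λ k → Injection.to ι (fold x f (toℕ k)))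
    = fold-repeats⇒fixed x i<j (Injection.injective ι eq)

module _ {c ℓ} (B : BALFI c ℓ) (ce : SatisfiesCe B) (cf : SatisfiesCf B) where

  open BALFI B renaming (¬_ to ∼_; ¬-cong to ∼-cong; ∨-¬ to ∨-∼)

  booleanAlgebra : BooleanAlgebra c ℓ
  booleanAlgebra = record { isBooleanAlgebra = isBooleanAlgebra }

  open BooleanAlgebra booleanAlgebra using (lattice)
  open BooleanAlgebraProperties booleanAlgebra
    using (∧-identityʳ; ∨-identityˡ) renaming (¬-involutive to complement-involutive)
  open LatticeProperties lattice using (∧-semilattice)
  open SemilatticeProperties ∧-semilattice using (poset)
  open Poset poset using (_≤_)
  open ≈-Reasoning setoid

  ∼-involutive : ∀ a → ∼ ∼ a ≈ a
  ∼-involutive a = trans (sym (cf a)) (ce a)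

  σ : Carrier → Carrier
  σ a = ∼ a ⟶ 0#

  -- `σ` is a composite of two involutions, `∼_` followed by the complement; undoing them in reverse
  -- order recovers `a` from `σ a`.
  σ-injective : Injective _≈_ _≈_ σ
  σ-injective {a} {b} σa≈σb = begin
    a                      ≈⟨ ∼-involutive a ⟨
    ∼ ∼ a                  ≈⟨ ∼-cong (complement-involutive (∼ a)) ⟨
    ∼ (σ a ⟶ 0#)           ≈⟨ ∼-cong (complement-cong σa≈σb) ⟩
    ∼ (σ b ⟶ 0#)           ≈⟨ ∼-cong (complement-involutive (∼ b)) ⟩
    ∼ ∼ b                  ≈⟨ ∼-involutive b ⟩
    b                      ∎

  -- The order is that of the meet semilattice, so the goal unfolds to `σ a ≈ σ a ∧ a`. Meeting
  -- `a ∨ ∼ a ≈ 1#` with `σ a` gives it, since `σ a` is disjoint from `∼ a`.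
  σ-deflationary : ∀ a → σ a ≤ a
  σ-deflationary a = begin
    σ a                    ≈⟨ ∧-identityʳ (σ a) ⟨
    σ a ∧ 1#               ≈⟨ ∧-cong refl (∨-∼ a) ⟨
    σ a ∧ (a ∨ ∼ a)        ≈⟨ ∧-distribˡ-∨ (σ a) a (∼ a) ⟩
    σ a ∧ a ∨ σ a ∧ ∼ a    ≈⟨ ∨-cong refl (∧-complementˡ (∼ a)) ⟩
    σ a ∧ a ∨ 0#           ≈⟨ ∨-comm _ _ ⟩
    0# ∨ σ a ∧ a           ≈⟨ ∨-identityˡ _ ⟩
    σ a ∧ a                ∎

  finite⇒explosive : Finite B → ∀ a → a ∧ ∼ a ≈ 0#
  finite⇒explosive (_ , B↔Fin) a = begin
    -- Trading `a` for `σ a` leaves the meet of `∼ a` with its own Boolean complement.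
    a ∧ ∼ a                ≈⟨ ∧-cong σ-fixes refl ⟨
    σ a ∧ ∼ a              ≈⟨ ∧-complementˡ (∼ a) ⟩
    0#                     ∎
    where
    σ-fixes : σ a ≈ a
    σ-fixes = finite-deflationary⇒identity poset σ-injective σ-deflationary
                (Inverse⇒Injection B↔Fin) a

corollary3p21 : ∀ {c ℓ : Level} →
    ¬ (∃ λ (B : BALFI c ℓ) → Finite B × Paraconsistent B × SatisfiesCe B × SatisfiesCf B)
corollary3p21 (B , finite , (a , a∧¬a≉0) , ce , cf) =
  a∧¬a≉0 (finite⇒explosive B ce cf finite a)
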